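{- Let $T$ be a theory, $\varphi$ a propositional formula, $V=\mathrm{var}(T)$, and $W=\mathrm{var}(T\cup\{\varphi\})$. Then: 1. $T$ has an equilibrium model iff $\models\exists V'\,\mathcal{T}_E[T]$; 2. some equilibrium model of $T$ satisfies $\varphi$ (written $T\mid\!\sim_b\varphi$) iff $\models\exists W'\big(\mathcal{T}_E[T]\wedge\varphi'\big)$; 3. all equilibrium models of $T$ satisfy $\varphi$ (written $T\mid\!\sim_s\varphi$) iff $\models\forall W'\big(\mathcal{T}_E[T]\supset\varphi'\big)$.
   Context: Formulas are built from atoms, the constants $\top,\bot$, and the primitive connectives $\neg,\wedge,\vee,\supset$. A theory is a finite set of formulas, identified with the conjunction of its elements (empty conjunction $=\top$); $\mathrm{var}(\cdot)$ is the set of variables occurring in a formula or theory. A classical interpretation is a set $I$ of atoms ($p$ is true iff $p\in I$). Priming: for each atom $p$, $p'$ is a globally new atom; $\varphi'$ replaces every atom $p$ of $\varphi$ by $p'$ (likewise for theories); for a set $I$ of atoms, $I'=\{p'\mid p\in I\}$. QBFs extend propositional formulas by quantifiers over atoms: under $I$, $\forall p\,\Psi$ is true iff both $\Psi[p/\top]$ and $\Psi[p/\bot]$ are true, $\exists p\,\Psi$ iff at least one is. $\models\Phi$ means $\Phi$ is true under every interpretation. $\exists P\,\Phi$, $\forall P\,\Phi$ for a finite set $P$ of atoms quantify all atoms of $P$. For indexed sets $S=\{\varphi_i\}$, $R=\{\psi_i\}$ of $n$ formulas, $S\le R$ abbreviates $\bigwedge_i(\varphi_i\supset\psi_i)$ and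 $S<R$ abbreviates $(S\le R)\wedge\neg(R\le S)$; in $V<V'$ the atom $p$ is paired with $p'$. HT: an HT-interpretation is a pair $\langle I_H,I_T\rangle$ of sets of atoms with $I_H\subseteq I_T$; worlds $H\le T$ ($\le$ reflexive). In world $w$: $\top$ true, $\bot$ false; atom $p$ true iff $p\in I_w$; $\wedge,\vee$ classical in $w$; $\neg\psi$ true iff $\psi$ is false in all $u\ge w$; $\varphi_1\supset\varphi_2$ true iff for all $u\ge w$, $\varphi_1$ is false in $u$ or $\varphi_2$ is true in $u$. The HT-interpretation satisfies (is an HT-model of) $\varphi$ iff $\varphi$ is true in $H$; it is an HT-model of a theory iff of all its elements. An equilibrium model of $T$ is a pair $\langle I,I\rangle$ that is an HT-model of $T$ such that for no $J\subset I$ (proper subset) is $\langle J,I\rangle$ an HT-model of $T$. Translation $\tau$: $\tau[\varphi]=\varphi$ if $\varphi$ is an atom, $\top$ or $\bot$; $\tau[\varphi_1\circ\varphi_2]=\tau[\varphi_1]\circ\tau[\varphi_2]$ for $\circ\in\{\wedge,\vee\}$; $\tau[\neg\psi]=\neg\psi'$; $\tau[\varphi_1\supset\varphi_2]=(\tau[\varphi_1]\supset\tau[\varphi_2])\wedge(\varphi_1'\supset\varphi_2')$. The encoding is $\mathcal{T}_E[T]=T'\wedge\neg\exists V\big((V<V')\wedge\tau[T]\big)$, where $V=\mathrm{var}(T)$.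
   Formalization: In claim 2 the direction from the QBF to brave consequence, and in claim 3 the direction from skeptical consequence to the QBF, are stated only for var(φ) ⊆ var(T); otherwise they fail (T = ∅ with φ = q, respectively φ = ¬q). -}

module Defs where

open import Data.Bool as Bool using (Bool; true; false; not; if_then_else_)
open import Data.Empty using (⊥)
open import Data.List using (List; []; _∷_; [_]; _++_; map; concatMap; foldr)
open import Data.List.Relation.Unary.All using (All)
open import Data.Product using (∃-syntax; _×_; proj₁)
open import Data.Sum using (_⊎_; inj₁; inj₂)
open import Data.Sum.Properties using (≡-dec)
open import Data.Unit using (⊤)
open import Data.Vec as Vec using (Vec; fromList; toList; zipWith)
open import Level using (0ℓ)
open import Relation.Binary.Definitions using (DecidableEquality)
open import Relation.Binary.PropositionalEquality using (_≡_)
open import Relation.Nullary using (¬_; does)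
open import Relation.Unary using (Pred; _⊆_; _⊂_)

infix  9 `¬_
infixr 8 _`∧_
infixr 7 _`∨_
infixr 6 _`⊃_

data Formula (P : Set) : Set where
  atom           : P → Formula P
  `⊤ `⊥          : Formula P
  `¬_            : Formula P → Formula P
  _`∧_ _`∨_ _`⊃_ : Formula P → Formula P → Formula P

-- Finite sets (of formulas, and below of atoms) are lists: order and repetitions
-- affect neither satisfaction of a theory nor the truth value of a QBF below.
Theory : Set → Set
Theory A = List (Formula A)

⋀ : ∀ {P} → List (Formula P) → Formula P
⋀ = foldr _`∧_ `⊤

var : ∀ {A} → Formula A → List A
var (atom p) = [ p ]
var `⊤       = []
var `⊥       = []
var (`¬ φ)   = var φ
var (φ `∧ ψ) = var φ ++ var ψ
var (φ `∨ ψ) = var φ ++ var ψ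
var (φ `⊃ ψ) = var φ ++ var ψ

varᵀ : ∀ {A} → Theory A → List A
varᵀ = concatMap var

-- A set of atoms is given by its characteristic function.
Interpretation : Set → Set
Interpretation P = P → Bool

⟦_⟧ : ∀ {P} → Interpretation P → Pred P 0ℓ
⟦ I ⟧ p = I p ≡ true


record HTInterpretation (A : Set) : Set where
  constructor ⟨_,_⟩[_]
  field
    here  : Interpretation A
    there : Interpretation A
    here⊆there : ⟦ here ⟧ ⊆ ⟦ there ⟧

data World : Set where
  H T : World

data _≤ʷ_ : World → World → Set where
  refl : ∀ {w} → w ≤ʷ w
  H≤T  : H ≤ʷ T

at : ∀ {A} → HTInterpretation A → World → Interpretation A
at M H = HTInterpretation.here M
at M T = HTInterpretation.there M

infix 4 _,_⊩_ _⊨ᴴᵀ_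

_,_⊩_ : ∀ {A} → HTInterpretation A → World → Formula A → Set
M , w ⊩ atom p   = at M w p ≡ true
M , w ⊩ `⊤       = ⊤
M , w ⊩ `⊥       = ⊥
M , w ⊩ (`¬ φ)   = ∀ u → w ≤ʷ u → ¬ (M , u ⊩ φ)
M , w ⊩ (φ `∧ ψ) = (M , w ⊩ φ) × (M , w ⊩ ψ)
M , w ⊩ (φ `∨ ψ) = (M , w ⊩ φ) ⊎ (M , w ⊩ ψ)
M , w ⊩ (φ `⊃ ψ) = ∀ u → w ≤ʷ u → ¬ (M , u ⊩ φ) ⊎ (M , u ⊩ ψ)

_⊨ᴴᵀ_ : ∀ {A} → HTInterpretation A → Formula A → Set
M ⊨ᴴᵀ φ = M , H ⊩ φ

HTModel : ∀ {A} → HTInterpretation A → Theory A → Set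
HTModel M Γ = All (M ⊨ᴴᵀ_) Γ

total : ∀ {A} → Interpretation A → HTInterpretation A
total I = ⟨ I , I ⟩[ (λ p∈I → p∈I) ]

-- EquilibriumModel Γ I : the pair ⟨ I , I ⟩ is an equilibrium model of Γ.
EquilibriumModel : ∀ {A} → Theory A → Interpretation A → Set
EquilibriumModel Γ I =
    HTModel (total I) Γ
  × (∀ J → (J⊂I : ⟦ J ⟧ ⊂ ⟦ I ⟧) → ¬ HTModel ⟨ J , I ⟩[ proj₁ J⊂I ] Γ)

HasEquilibriumModel : ∀ {A} → Theory A → Set
HasEquilibriumModel Γ = ∃[ I ] EquilibriumModel Γ I

infix 4 _∣∼ᵇ_ _∣∼ˢ_

_∣∼ᵇ_ : ∀ {A} → Theory A → Formula A → Set
Γ ∣∼ᵇ φ = ∃[ I ] (EquilibriumModel Γ I × total I ⊨ᴴᵀ φ)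

_∣∼ˢ_ : ∀ {A} → Theory A → Formula A → Set
Γ ∣∼ˢ φ = ∀ I → EquilibriumModel Γ I → total I ⊨ᴴᵀ φ


data QBF (P : Set) : Set where
  atom           : P → QBF P
  `⊤ `⊥          : QBF P
  `¬_            : QBF P → QBF P
  _`∧_ _`∨_ _`⊃_ : QBF P → QBF P → QBF P
  `∀ `∃          : P → QBF P → QBF P

⌜_⌝ : ∀ {P} → Formula P → QBF P
⌜ atom p ⌝ = atom p
⌜ `⊤ ⌝     = `⊤
⌜ `⊥ ⌝     = `⊥
⌜ `¬ φ ⌝   = `¬ ⌜ φ ⌝
⌜ φ `∧ ψ ⌝ = ⌜ φ ⌝ `∧ ⌜ ψ ⌝
⌜ φ `∨ ψ ⌝ = ⌜ φ ⌝ `∨ ⌜ ψ ⌝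
⌜ φ `⊃ ψ ⌝ = ⌜ φ ⌝ `⊃ ⌜ ψ ⌝

∃* ∀* : ∀ {P} → List P → QBF P → QBF P
∃* ps Φ = foldr `∃ Φ ps
∀* ps Φ = foldr `∀ Φ ps

module Semantics {P : Set} (_≟_ : DecidableEquality P) where

  infix 10 _[_/_]
  infix 4  _⊢_⇓_
  infix 4  ⊨_

  const : Bool → QBF P
  const true  = `⊤
  const false = `⊥

  -- Replaces the free occurrences of p by the truth constant c.
  _[_/_] : QBF P → P → Bool → QBF P
  atom q   [ p / c ] = if does (p ≟ q) then const c else atom q
  `⊤       [ p / c ] = `⊤
  `⊥       [ p / c ] = `⊥
  (`¬ Φ)   [ p / c ] = `¬ (Φ [ p / c ])
  (Φ `∧ Ψ) [ p / c ] = (Φ [ p / c ]) `∧ (Ψ [ p / c ])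
  (Φ `∨ Ψ) [ p / c ] = (Φ [ p / c ]) `∨ (Ψ [ p / c ])
  (Φ `⊃ Ψ) [ p / c ] = (Φ [ p / c ]) `⊃ (Ψ [ p / c ])
  `∀ q Φ   [ p / c ] = if does (p ≟ q) then `∀ q Φ else `∀ q (Φ [ p / c ])
  `∃ q Φ   [ p / c ] = if does (p ≟ q) then `∃ q Φ else `∃ q (Φ [ p / c ])

  -- I ⊢ Φ ⇓ b : Φ has truth value b under I.  It is a relation because the
  -- instances of a quantified formula are not its structural subterms.
  data _⊢_⇓_ (I : Interpretation P) : QBF P → Bool → Set where
    atom : ∀ p → I ⊢ atom p ⇓ I p
    `⊤   : I ⊢ `⊤ ⇓ true
    `⊥   : I ⊢ `⊥ ⇓ false
    `¬_  : ∀ {Φ b} → I ⊢ Φ ⇓ b → I ⊢ `¬ Φ ⇓ not b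
    _`∧_ : ∀ {Φ Ψ b c} → I ⊢ Φ ⇓ b → I ⊢ Ψ ⇓ c → I ⊢ Φ `∧ Ψ ⇓ (b Bool.∧ c)
    _`∨_ : ∀ {Φ Ψ b c} → I ⊢ Φ ⇓ b → I ⊢ Ψ ⇓ c → I ⊢ Φ `∨ Ψ ⇓ (b Bool.∨ c)
    _`⊃_ : ∀ {Φ Ψ b c} → I ⊢ Φ ⇓ b → I ⊢ Ψ ⇓ c → I ⊢ Φ `⊃ Ψ ⇓ (not b Bool.∨ c)
    `∀   : ∀ {p Φ b c} → I ⊢ Φ [ p / true ] ⇓ b → I ⊢ Φ [ p / false ] ⇓ c →
           I ⊢ `∀ p Φ ⇓ (b Bool.∧ c)
    `∃   : ∀ {p Φ b c} → I ⊢ Φ [ p / true ] ⇓ b → I ⊢ Φ [ p / false ] ⇓ c →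
           I ⊢ `∃ p Φ ⇓ (b Bool.∨ c)

  ⊨_ : QBF P → Set
  ⊨ Φ = ∀ I → I ⊢ Φ ⇓ true


-- The original atoms are the left summand, their new copies p′ the right one.
Atom⁺ : Set → Set
Atom⁺ A = A ⊎ A

rename : ∀ {P Q} → (P → Q) → Formula P → Formula Q
rename f (atom p) = atom (f p)
rename f `⊤       = `⊤
rename f `⊥       = `⊥
rename f (`¬ φ)   = `¬ rename f φ
rename f (φ `∧ ψ) = rename f φ `∧ rename f ψ
rename f (φ `∨ ψ) = rename f φ `∨ rename f ψ
rename f (φ `⊃ ψ) = rename f φ `⊃ rename f ψ

infix 10 _′

_′ : ∀ {A} → Formula A → Formula (Atom⁺ A)
_′ = rename inj₂

unprimed primed : ∀ {A} → List A → List (Atom⁺ A)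
unprimed = map inj₁
primed   = map inj₂

infix 7 _≤ᶠ_ _<ᶠ_

_≤ᶠ_ _<ᶠ_ : ∀ {P n} → Vec (Formula P) n → Vec (Formula P) n → Formula P
S ≤ᶠ R = ⋀ (toList (zipWith _`⊃_ S R))
S <ᶠ R = (S ≤ᶠ R) `∧ `¬ (R ≤ᶠ S)

_<′ : ∀ {A} → List A → Formula (Atom⁺ A)
V <′ = Vec.map (λ p → atom (inj₁ p)) (fromList V)
    <ᶠ Vec.map (λ p → atom (inj₂ p)) (fromList V)

τ : ∀ {A} → Formula A → Formula (Atom⁺ A)
τ (atom p) = atom (inj₁ p)
τ `⊤       = `⊤
τ `⊥       = `⊥
τ (`¬ φ)   = `¬ (φ ′)
τ (φ `∧ ψ) = τ φ `∧ τ ψ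
τ (φ `∨ ψ) = τ φ `∨ τ ψ
τ (φ `⊃ ψ) = (τ φ `⊃ τ ψ) `∧ (φ ′ `⊃ ψ ′)

𝒯ᴱ : ∀ {A} → Theory A → QBF (Atom⁺ A)
𝒯ᴱ Γ = ⌜ (⋀ Γ) ′ ⌝ `∧ `¬ ∃* (unprimed V) ⌜ V <′ `∧ τ (⋀ Γ) ⌝
  where V = varᵀ Γ

module QBFSemantics {A : Set} (_≟_ : DecidableEquality A) =
  Semantics {Atom⁺ A} (≡-dec _≟_ _≟_)

{-# OPTIONS --safe #-}
module Submission where

-- Fix a theory Γ with variables V.  Read an interpretation K of the doubled
-- alphabet as a pair of interpretations, the unprimed part K ∘ inj₁ being the
-- world H and the primed part K ∘ inj₂ the world T.  If K agrees with an
-- HT-interpretation M on var φ in this way, then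
--
--   * φ ′ is true in K iff φ holds at the world T of M (primed-reflects), and
--   * τ φ is true in K iff φ holds at the world H of M (τ-reflects);
--
-- both are inductions on φ, the second using persistence for negation.  The
-- first holds equally at the world H of a total interpretation.
--
-- Hence 𝒯ᴱ Γ is true in K exactly when the primed part I of K is a total model
-- of Γ and no choice of the atoms of V yields a J strictly below I with
-- ⟨ J , I ⟩ a model, i.e. when I is an equilibrium model (encoding).  The
-- encoding only sees V, while an equilibrium model is a set of arbitrary atoms;
-- the two notions match on interpretations whose true atoms all lie in V.  Every
-- equilibrium model is of this kind, because discarding its atoms outside V
-- leaves a model and so cannot be a proper shrinking (equilibrium-supported).
-- Conversely every K with 𝒯ᴱ Γ true yields an equilibrium model, by cutting the
-- primed part of K down to V (decode).  The three claims follow by unfolding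
-- the outer quantifier block.
--
-- Truth of a QBF is handled through a Boolean evaluator that interprets
-- quantifiers by updating the interpretation.  It agrees with the
-- substitution-based semantics because substituting a constant for p amounts to
-- updating the interpretation at p (eval-subst).  Its values being Booleans, all
-- case distinctions are on decidable propositions.

open import Defs
open import Data.Bool using (Bool; true; false; not; if_then_else_; _∧_; _∨_)
open import Data.Bool.Properties using (∧-conicalˡ; ∧-conicalʳ)
open import Data.Empty using (⊥-elim)
open import Data.List using (List; []; _∷_; _++_)
open import Data.List.Membership.Propositional using (_∈_; _∉_)
open import Data.List.Membership.Propositional.Properties
  using (∈-++⁺ˡ; ∈-++⁺ʳ; ∈-map⁺; ∈-map⁻)
import Data.List.Membership.DecPropositional as DecMembership
open import Data.List.Relation.Binary.Subset.Propositional using (_⊆_)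
open import Data.List.Relation.Unary.All as All using (All; []; _∷_)
open import Data.List.Relation.Unary.Any using (here; there)
open import Data.Product using (_×_; _,_; proj₁; proj₂; ∃-syntax)
open import Data.Sum using (inj₁; inj₂; [_,_]′)
open import Data.Sum.Properties using (≡-dec)
open import Data.Unit using (tt)
open import Data.Vec as Vec using (fromList)
open import Function.Base using (_∘_; const; id)
open import Function.Bundles using (_⇔_; mk⇔; module Equivalence)
open import Relation.Binary.Definitions using (DecidableEquality)
open import Relation.Binary.PropositionalEquality
  using (_≡_; _≢_; _≗_; refl; sym; trans; cong; cong₂; subst)
open import Relation.Nullary using (¬_; does; yes; no)
open import Relation.Nullary.Reflects
  using (Reflects; ofʸ; ofⁿ; of; invert; ¬-reflects; _×-reflects_; _⊎-reflects_; _→-reflects_)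
import Relation.Unary as Unary

open Equivalence using (to; from)

-- Booleans as truth values

reflects-map : ∀ {A B : Set} {b} → (A → B) → (B → A) → Reflects A b → Reflects B b
reflects-map f g (ofʸ a)  = of (f a)
reflects-map f g (ofⁿ ¬a) = of (¬a ∘ g)

reflects-≡true : ∀ {a b} → a ≡ b → Reflects (b ≡ true) a
reflects-≡true {true}  refl = of refl
reflects-≡true {false} refl = of λ ()

reflects⇒⇔ : ∀ {A : Set} {b} → Reflects A b → b ≡ true ⇔ A
reflects⇒⇔ (ofʸ a)  = mk⇔ (const a) (const refl)
reflects⇒⇔ (ofⁿ ¬a) = mk⇔ (λ ()) (⊥-elim ∘ ¬a)

any-Bool : ∀ (f : Bool → Bool) → f true ∨ f false ≡ true ⇔ (∃[ c ] f c ≡ true)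
any-Bool f with f true in eqᵗ | f false in eqᶠ
... | true  | _     = mk⇔ (λ _ → true , eqᵗ) (const refl)
... | false | true  = mk⇔ (λ _ → false , eqᶠ) (const refl)
... | false | false = mk⇔ (λ ()) λ where
  (true  , eq) → trans (sym eqᵗ) eq
  (false , eq) → trans (sym eqᶠ) eq

all-Bool : ∀ (f : Bool → Bool) → f true ∧ f false ≡ true ⇔ (∀ c → f c ≡ true)
all-Bool f = mk⇔
  (λ { eq true → ∧-conicalˡ _ _ eq ; eq false → ∧-conicalʳ _ _ eq })
  (λ h → cong₂ _∧_ (h true) (h false))

-- Agreement and overriding of interpretations

infix 4 _≐_on_ _≐_off_

-- Agreement at the atoms of ps, and at the atoms not in ps.
_≐_on_ _≐_off_ : ∀ {P} → Interpretation P → Interpretation P → List P → Set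
I ≐ J on  ps = ∀ {p} → p ∈ ps → I p ≡ J p
I ≐ J off ps = ∀ {p} → p ∉ ps → I p ≡ J p

module Override {P : Set} (_≟_ : DecidableEquality P) where

  open DecMembership _≟_ using (_∈?_)

  -- I on ps and J elsewhere.
  override : List P → Interpretation P → Interpretation P → Interpretation P
  override ps I J p = if does (p ∈? ps) then I p else J p

  override-on : ∀ ps I J → override ps I J ≐ I on ps
  override-on ps I J {p} p∈ps with p ∈? ps
  ... | yes _   = refl
  ... | no p∉ps = ⊥-elim (p∉ps p∈ps)

  override-off : ∀ ps I J → override ps I J ≐ J off ps
  override-off ps I J {p} p∉ps with p ∈? ps
  ... | yes p∈ps = ⊥-elim (p∉ps p∈ps)
  ... | no _     = refl

  -- The restriction I ∩ ps of a set of atoms to a finite one.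
  restrict : List P → Interpretation P → Interpretation P
  restrict ps I = override ps I (const false)

  restrict-on : ∀ ps I → restrict ps I ≐ I on ps
  restrict-on ps I = override-on ps I (const false)

  ∈-restrict : ∀ ps I {p} → restrict ps I p ≡ true → p ∈ ps × I p ≡ true
  ∈-restrict ps I {p} eq with p ∈? ps
  ∈-restrict ps I eq | yes p∈ps = p∈ps , eq
  ∈-restrict ps I () | no _

-- Evaluating quantified Boolean formulas

module Evaluation {P : Set} (_≟_ : DecidableEquality P) where

  open Semantics _≟_ renaming (const to constant)

  infix 10 _[_≔_]

  -- K with the value of p changed to c.
  _[_≔_] : Interpretation P → P → Bool → Interpretation P
  (K [ p ≔ c ]) q = if does (p ≟ q) then c else K q

  ≔-other : ∀ K {p q} c → p ≢ q → (K [ p ≔ c ]) q ≡ K q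
  ≔-other K {p} {q} c p≢q with p ≟ q
  ... | yes p≡q = ⊥-elim (p≢q p≡q)
  ... | no _    = refl

  ≔-cong : ∀ {K L} → K ≗ L → ∀ p c → K [ p ≔ c ] ≗ L [ p ≔ c ]
  ≔-cong K≗L p c q with p ≟ q
  ... | yes _ = refl
  ... | no _  = K≗L q

  ≔-overwrite : ∀ K p c d → K [ p ≔ d ] ≗ K [ p ≔ c ] [ p ≔ d ]
  ≔-overwrite K p c d q with p ≟ q
  ... | yes _ = refl
  ... | no _  = refl

  ≔-comm : ∀ K {p q} c d → p ≢ q → K [ q ≔ d ] [ p ≔ c ] ≗ K [ p ≔ c ] [ q ≔ d ]
  ≔-comm K {p} {q} c d p≢q r with q ≟ r | p ≟ r
  ... | yes q≡r | yes p≡r = ⊥-elim (p≢q (trans p≡r (sym q≡r)))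
  ... | yes _   | no _    = refl
  ... | no _    | yes _   = refl
  ... | no _    | no _    = refl

  -- The truth value of a QBF, with quantifiers ranging over the two updates of
  -- the interpretation at the bound atom.
  eval : Interpretation P → QBF P → Bool
  eval K (atom p) = K p
  eval K `⊤       = true
  eval K `⊥       = false
  eval K (`¬ Φ)   = not (eval K Φ)
  eval K (Φ `∧ Ψ) = eval K Φ ∧ eval K Ψ
  eval K (Φ `∨ Ψ) = eval K Φ ∨ eval K Ψ
  eval K (Φ `⊃ Ψ) = not (eval K Φ) ∨ eval K Ψ
  eval K (`∀ p Φ) = eval (K [ p ≔ true ]) Φ ∧ eval (K [ p ≔ false ]) Φ
  eval K (`∃ p Φ) = eval (K [ p ≔ true ]) Φ ∨ eval (K [ p ≔ false ]) Φ

  eval-cong : ∀ {K L} → K ≗ L → ∀ Φ → eval K Φ ≡ eval L Φ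
  eval-cong K≗L (atom p) = K≗L p
  eval-cong K≗L `⊤       = refl
  eval-cong K≗L `⊥       = refl
  eval-cong K≗L (`¬ Φ)   = cong not (eval-cong K≗L Φ)
  eval-cong K≗L (Φ `∧ Ψ) = cong₂ _∧_ (eval-cong K≗L Φ) (eval-cong K≗L Ψ)
  eval-cong K≗L (Φ `∨ Ψ) = cong₂ _∨_ (eval-cong K≗L Φ) (eval-cong K≗L Ψ)
  eval-cong K≗L (Φ `⊃ Ψ) = cong₂ (λ b c → not b ∨ c) (eval-cong K≗L Φ) (eval-cong K≗L Ψ)
  eval-cong K≗L (`∀ p Φ) =
    cong₂ _∧_ (eval-cong (≔-cong K≗L p true) Φ) (eval-cong (≔-cong K≗L p false) Φ)
  eval-cong K≗L (`∃ p Φ) =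
    cong₂ _∨_ (eval-cong (≔-cong K≗L p true) Φ) (eval-cong (≔-cong K≗L p false) Φ)

  -- At a quantifier over p itself the substitution stops, and the update at p is
  -- overwritten.
  eval-subst : ∀ K Φ p c → eval K (Φ [ p / c ]) ≡ eval (K [ p ≔ c ]) Φ
  eval-subst K (atom q) p c with p ≟ q
  eval-subst K (atom q) p true  | yes _ = refl
  eval-subst K (atom q) p false | yes _ = refl
  eval-subst K (atom q) p c     | no _  = refl
  eval-subst K `⊤       p c = refl
  eval-subst K `⊥       p c = refl
  eval-subst K (`¬ Φ)   p c = cong not (eval-subst K Φ p c)
  eval-subst K (Φ `∧ Ψ) p c = cong₂ _∧_ (eval-subst K Φ p c) (eval-subst K Ψ p c)
  eval-subst K (Φ `∨ Ψ) p c = cong₂ _∨_ (eval-subst K Φ p c) (eval-subst K Ψ p c)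
  eval-subst K (Φ `⊃ Ψ) p c =
    cong₂ (λ a b → not a ∨ b) (eval-subst K Φ p c) (eval-subst K Ψ p c)
  eval-subst K (`∀ q Φ) p c with p ≟ q
  ... | yes refl = cong₂ _∧_ (eval-cong (≔-overwrite K p c true) Φ)
                             (eval-cong (≔-overwrite K p c false) Φ)
  ... | no p≢q = cong₂ _∧_ (under true) (under false)
    where
    under : ∀ d → eval (K [ q ≔ d ]) (Φ [ p / c ]) ≡ eval (K [ p ≔ c ] [ q ≔ d ]) Φ
    under d = trans (eval-subst (K [ q ≔ d ]) Φ p c) (eval-cong (≔-comm K c d p≢q) Φ)
  eval-subst K (`∃ q Φ) p c with p ≟ q
  ... | yes refl = cong₂ _∨_ (eval-cong (≔-overwrite K p c true) Φ)
                             (eval-cong (≔-overwrite K p c false) Φ)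
  ... | no p≢q = cong₂ _∨_ (under true) (under false)
    where
    under : ∀ d → eval (K [ q ≔ d ]) (Φ [ p / c ]) ≡ eval (K [ p ≔ c ] [ q ≔ d ]) Φ
    under d = trans (eval-subst (K [ q ≔ d ]) Φ p c) (eval-cong (≔-comm K c d p≢q) Φ)

  ⇓⇒eval : ∀ {K Φ b} → K ⊢ Φ ⇓ b → b ≡ eval K Φ
  ⇓⇒eval (atom p) = refl
  ⇓⇒eval `⊤       = refl
  ⇓⇒eval `⊥       = refl
  ⇓⇒eval (`¬ d)   = cong not (⇓⇒eval d)
  ⇓⇒eval (d `∧ e) = cong₂ _∧_ (⇓⇒eval d) (⇓⇒eval e)
  ⇓⇒eval (d `∨ e) = cong₂ _∨_ (⇓⇒eval d) (⇓⇒eval e)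
  ⇓⇒eval (d `⊃ e) = cong₂ (λ b c → not b ∨ c) (⇓⇒eval d) (⇓⇒eval e)
  ⇓⇒eval {K} (`∀ {p} {Φ} d e) =
    cong₂ _∧_ (trans (⇓⇒eval d) (eval-subst K Φ p true))
              (trans (⇓⇒eval e) (eval-subst K Φ p false))
  ⇓⇒eval {K} (`∃ {p} {Φ} d e) =
    cong₂ _∨_ (trans (⇓⇒eval d) (eval-subst K Φ p true))
              (trans (⇓⇒eval e) (eval-subst K Φ p false))

  -- Instance Φ Ψ : Ψ is Φ with some occurrences of atoms replaced by constants.
  -- Induction on Φ then covers the instances of a quantified formula.
  data Instance : QBF P → QBF P → Set where
    atom  : ∀ {p} → Instance (atom p) (atom p)
    fixed : ∀ {p} c → Instance (atom p) (constant c)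
    `⊤    : Instance `⊤ `⊤
    `⊥    : Instance `⊥ `⊥
    `¬_   : ∀ {Φ Φ₁} → Instance Φ Φ₁ → Instance (`¬ Φ) (`¬ Φ₁)
    _`∧_  : ∀ {Φ Φ₁ Ψ Ψ₁} → Instance Φ Φ₁ → Instance Ψ Ψ₁ → Instance (Φ `∧ Ψ) (Φ₁ `∧ Ψ₁)
    _`∨_  : ∀ {Φ Φ₁ Ψ Ψ₁} → Instance Φ Φ₁ → Instance Ψ Ψ₁ → Instance (Φ `∨ Ψ) (Φ₁ `∨ Ψ₁)
    _`⊃_  : ∀ {Φ Φ₁ Ψ Ψ₁} → Instance Φ Φ₁ → Instance Ψ Ψ₁ → Instance (Φ `⊃ Ψ) (Φ₁ `⊃ Ψ₁)
    `∀    : ∀ {p Φ Φ₁} → Instance Φ Φ₁ → Instance (`∀ p Φ) (`∀ p Φ₁)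
    `∃    : ∀ {p Φ Φ₁} → Instance Φ Φ₁ → Instance (`∃ p Φ) (`∃ p Φ₁)

  Instance-refl : ∀ Φ → Instance Φ Φ
  Instance-refl (atom p) = atom
  Instance-refl `⊤       = `⊤
  Instance-refl `⊥       = `⊥
  Instance-refl (`¬ Φ)   = `¬ Instance-refl Φ
  Instance-refl (Φ `∧ Ψ) = Instance-refl Φ `∧ Instance-refl Ψ
  Instance-refl (Φ `∨ Ψ) = Instance-refl Φ `∨ Instance-refl Ψ
  Instance-refl (Φ `⊃ Ψ) = Instance-refl Φ `⊃ Instance-refl Ψ
  Instance-refl (`∀ p Φ) = `∀ (Instance-refl Φ)
  Instance-refl (`∃ p Φ) = `∃ (Instance-refl Φ)

  Instance-subst : ∀ {Φ Ψ} p c → Instance Φ Ψ → Instance Φ (Ψ [ p / c ])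
  Instance-subst p c (atom {q}) with p ≟ q
  ... | yes _ = fixed c
  ... | no _  = atom
  Instance-subst p c (fixed true)  = fixed true
  Instance-subst p c (fixed false) = fixed false
  Instance-subst p c `⊤       = `⊤
  Instance-subst p c `⊥       = `⊥
  Instance-subst p c (`¬ i)   = `¬ Instance-subst p c i
  Instance-subst p c (i `∧ j) = Instance-subst p c i `∧ Instance-subst p c j
  Instance-subst p c (i `∨ j) = Instance-subst p c i `∨ Instance-subst p c j
  Instance-subst p c (i `⊃ j) = Instance-subst p c i `⊃ Instance-subst p c j
  Instance-subst p c (`∀ {q} i) with p ≟ q
  ... | yes _ = `∀ i
  ... | no _  = `∀ (Instance-subst p c i)
  Instance-subst p c (`∃ {q} i) with p ≟ q
  ... | yes _ = `∃ i
  ... | no _  = `∃ (Instance-subst p c i)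

  ⇓-total : ∀ K Φ {Ψ} → Instance Φ Ψ → ∃[ b ] K ⊢ Ψ ⇓ b
  ⇓-total K (atom p) atom          = _ , atom p
  ⇓-total K (atom p) (fixed true)  = _ , `⊤
  ⇓-total K (atom p) (fixed false) = _ , `⊥
  ⇓-total K `⊤       `⊤       = _ , `⊤
  ⇓-total K `⊥       `⊥       = _ , `⊥
  ⇓-total K (`¬ Φ)   (`¬ i)   = _ , `¬ proj₂ (⇓-total K Φ i)
  ⇓-total K (Φ `∧ Ψ) (i `∧ j) = _ , proj₂ (⇓-total K Φ i) `∧ proj₂ (⇓-total K Ψ j)
  ⇓-total K (Φ `∨ Ψ) (i `∨ j) = _ , proj₂ (⇓-total K Φ i) `∨ proj₂ (⇓-total K Ψ j)
  ⇓-total K (Φ `⊃ Ψ) (i `⊃ j) = _ , proj₂ (⇓-total K Φ i) `⊃ proj₂ (⇓-total K Ψ j)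
  ⇓-total K (`∀ p Φ) (`∀ i)   =
    _ , `∀ (proj₂ (⇓-total K Φ (Instance-subst p true i)))
           (proj₂ (⇓-total K Φ (Instance-subst p false i)))
  ⇓-total K (`∃ p Φ) (`∃ i)   =
    _ , `∃ (proj₂ (⇓-total K Φ (Instance-subst p true i)))
           (proj₂ (⇓-total K Φ (Instance-subst p false i)))

  eval⇒⇓ : ∀ K Φ → K ⊢ Φ ⇓ eval K Φ
  eval⇒⇓ K Φ with b , d ← ⇓-total K Φ (Instance-refl Φ) = subst (K ⊢ Φ ⇓_) (⇓⇒eval d) d

  ⊨⇔eval : ∀ Φ → (⊨ Φ) ⇔ (∀ K → eval K Φ ≡ true)
  ⊨⇔eval Φ = mk⇔ (λ ⊨Φ K → sym (⇓⇒eval (⊨Φ K)))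
                 (λ h K → subst (K ⊢ Φ ⇓_) (h K) (eval⇒⇓ K Φ))

  -- Quantifying over p leaves the values off p ∷ ps untouched.
  off-∷⁺ : ∀ {K L p c ps} → K [ p ≔ c ] ≐ L off ps → K ≐ L off p ∷ ps
  off-∷⁺ {K} {c = c} agree q∉ =
    trans (sym (≔-other K c (q∉ ∘ here ∘ sym))) (agree (q∉ ∘ there))

  off-∷⁻ : ∀ {K L p ps} → K ≐ L off p ∷ ps → K [ p ≔ L p ] ≐ L off ps
  off-∷⁻ {p = p} agree {q} q∉ with p ≟ q
  ... | yes refl = refl
  ... | no p≢q   = agree λ { (here q≡p) → p≢q (sym q≡p) ; (there q∈) → q∉ q∈ }

  -- A quantifier block ranges over the interpretations that differ from K only on
  -- the quantified atoms.
  eval-∃* : ∀ ps Φ K →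
    eval K (∃* ps Φ) ≡ true ⇔ (∃[ L ] (K ≐ L off ps × eval L Φ ≡ true))
  eval-∃* [] Φ K = mk⇔ f g
    where
    f : eval K Φ ≡ true → ∃[ L ] (K ≐ L off [] × eval L Φ ≡ true)
    f eq = K , (λ _ → refl) , eq
    g : ∃[ L ] (K ≐ L off [] × eval L Φ ≡ true) → eval K Φ ≡ true
    g (L , agree , eq) = trans (eval-cong (λ p → agree λ ()) Φ) eq
  eval-∃* (p ∷ ps) Φ K = mk⇔ f g
    where
    split = any-Bool λ c → eval (K [ p ≔ c ]) (∃* ps Φ)
    f : eval K (∃* (p ∷ ps) Φ) ≡ true → ∃[ L ] (K ≐ L off p ∷ ps × eval L Φ ≡ true)
    f eq with c , eq′ ← to split eq
         with L , agree , eq″ ← to (eval-∃* ps Φ (K [ p ≔ c ])) eq′ =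
      L , off-∷⁺ {K} {L} agree , eq″
    g : ∃[ L ] (K ≐ L off p ∷ ps × eval L Φ ≡ true) → eval K (∃* (p ∷ ps) Φ) ≡ true
    g (L , agree , eq) =
      from split (L p , from (eval-∃* ps Φ (K [ p ≔ L p ])) (L , off-∷⁻ {K} {L} agree , eq))

  eval-∀* : ∀ ps Φ K →
    eval K (∀* ps Φ) ≡ true ⇔ (∀ L → K ≐ L off ps → eval L Φ ≡ true)
  eval-∀* [] Φ K = mk⇔ f g
    where
    f : eval K Φ ≡ true → ∀ L → K ≐ L off [] → eval L Φ ≡ true
    f eq L agree = trans (sym (eval-cong (λ p → agree λ ()) Φ)) eq
    g : (∀ L → K ≐ L off [] → eval L Φ ≡ true) → eval K Φ ≡ true
    g h = h K (λ _ → refl)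
  eval-∀* (p ∷ ps) Φ K = mk⇔ f g
    where
    split = all-Bool λ c → eval (K [ p ≔ c ]) (∀* ps Φ)
    f : eval K (∀* (p ∷ ps) Φ) ≡ true → ∀ L → K ≐ L off p ∷ ps → eval L Φ ≡ true
    f eq L agree =
      to (eval-∀* ps Φ (K [ p ≔ L p ])) (to split eq (L p)) L (off-∷⁻ {K} {L} agree)
    g : (∀ L → K ≐ L off p ∷ ps → eval L Φ ≡ true) → eval K (∀* (p ∷ ps) Φ) ≡ true
    g h = from split λ c → from (eval-∀* ps Φ (K [ p ≔ c ])) λ L agree →
      h L (off-∷⁺ {K} {L} agree)

-- The logic of here-and-there

≤ʷ-trans : ∀ {u v w} → u ≤ʷ v → v ≤ʷ w → u ≤ʷ w
≤ʷ-trans refl v≤w  = v≤w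
≤ʷ-trans H≤T  refl = H≤T

persistence : ∀ {A} (M : HTInterpretation A) φ → M , H ⊩ φ → M , T ⊩ φ
persistence M (atom p) h          = HTInterpretation.here⊆there M h
persistence M `⊤       h          = h
persistence M (`¬ φ)   h u T≤u    = h u (≤ʷ-trans H≤T T≤u)
persistence M (φ `∧ ψ) (h₁ , h₂)  = persistence M φ h₁ , persistence M ψ h₂
persistence M (φ `∨ ψ) (inj₁ h)   = inj₁ (persistence M φ h)
persistence M (φ `∨ ψ) (inj₂ h)   = inj₂ (persistence M ψ h)
persistence M (φ `⊃ ψ) h u T≤u    = h u (≤ʷ-trans H≤T T≤u)

HTModel⇔⋀ : ∀ {A} {M : HTInterpretation A} Γ → HTModel M Γ ⇔ (M ⊨ᴴᵀ ⋀ Γ)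
HTModel⇔⋀ Γ = mk⇔ (f Γ) (g Γ)
  where
  f : ∀ Γ → HTModel _ Γ → _ ⊨ᴴᵀ ⋀ Γ
  f []      []       = tt
  f (φ ∷ Γ) (h ∷ hs) = h , f Γ hs
  g : ∀ Γ → _ ⊨ᴴᵀ ⋀ Γ → HTModel _ Γ
  g []      _        = []
  g (φ ∷ Γ) (h , hs) = h ∷ g Γ hs

var-⋀ : ∀ {A} (Γ : Theory A) → var (⋀ Γ) ≡ varᵀ Γ
var-⋀ []      = refl
var-⋀ (φ ∷ Γ) = cong (var φ ++_) (var-⋀ Γ)

-- If a property of worlds has one truth value b at all u ≥ w, then b is also the
-- truth value of its holding at all of them.
∀≥-reflects : ∀ {B : World → Set} {b w} → (∀ {u} → w ≤ʷ u → Reflects (B u) b) →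
              Reflects (∀ u → w ≤ʷ u → B u) b
∀≥-reflects {b = true}  r = of λ u w≤u → invert (r w≤u)
∀≥-reflects {b = false} r = of λ h → invert (r refl) (h _ refl)

-- Correctness of the encoding

module Encoding {A : Set} (_≟_ : DecidableEquality A) where

  open Evaluation (≡-dec _≟_ _≟_)
  open DecMembership _≟_ using (_∈?_)
  open Override _≟_ using (restrict; restrict-on; ∈-restrict)
  open Override (≡-dec _≟_ _≟_) using (override; override-on; override-off)

  -- Stated at any world w above which all worlds look alike on var φ, so that it
  -- covers both the world T of any HT-interpretation and the world H of a total
  -- one, and is preserved when the induction passes to a world above w.
  primed-reflects : ∀ {M K} φ {w} →
    (∀ {u} → w ≤ʷ u → (K ∘ inj₂) ≐ at M u on var φ) →
    Reflects (M , w ⊩ φ) (eval K ⌜ φ ′ ⌝)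
  primed-reflects (atom p) agree = reflects-≡true (agree refl (here refl))
  primed-reflects `⊤       agree = of tt
  primed-reflects `⊥       agree = of id
  primed-reflects (`¬ φ)   agree =
    ∀≥-reflects λ w≤u → ¬-reflects (primed-reflects φ (agree ∘ ≤ʷ-trans w≤u))
  primed-reflects (φ `∧ ψ) agree =
    primed-reflects φ (λ w≤u → agree w≤u ∘ ∈-++⁺ˡ)
      ×-reflects primed-reflects ψ (λ w≤u → agree w≤u ∘ ∈-++⁺ʳ (var φ))
  primed-reflects (φ `∨ ψ) agree =
    primed-reflects φ (λ w≤u → agree w≤u ∘ ∈-++⁺ˡ)
      ⊎-reflects primed-reflects ψ (λ w≤u → agree w≤u ∘ ∈-++⁺ʳ (var φ))
  primed-reflects (φ `⊃ ψ) agree = ∀≥-reflects λ w≤u →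
    ¬-reflects (primed-reflects φ (λ u≤v → agree (≤ʷ-trans w≤u u≤v) ∘ ∈-++⁺ˡ))
      ⊎-reflects primed-reflects ψ (λ u≤v → agree (≤ʷ-trans w≤u u≤v) ∘ ∈-++⁺ʳ (var φ))

  primed-reflectsᵀ : ∀ {M K} φ → (K ∘ inj₂) ≐ at M T on var φ →
                     Reflects (M , T ⊩ φ) (eval K ⌜ φ ′ ⌝)
  primed-reflectsᵀ φ agree = primed-reflects φ λ { refl → agree }

  primed-reflects-total : ∀ {I K} φ → (K ∘ inj₂) ≐ I on var φ →
                          Reflects (total I ⊨ᴴᵀ φ) (eval K ⌜ φ ′ ⌝)
  primed-reflects-total φ agree = primed-reflects φ λ { refl → agree ; H≤T → agree }

  τ-reflects : ∀ {M K} φ →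
    (K ∘ inj₁) ≐ at M H on var φ → (K ∘ inj₂) ≐ at M T on var φ →
    Reflects (M , H ⊩ φ) (eval K ⌜ τ φ ⌝)
  τ-reflects (atom p) agreeᴴ agreeᵀ = reflects-≡true (agreeᴴ (here refl))
  τ-reflects `⊤       agreeᴴ agreeᵀ = of tt
  τ-reflects `⊥       agreeᴴ agreeᵀ = of id
  τ-reflects {M} (`¬ φ) agreeᴴ agreeᵀ = reflects-map
    (λ { ¬t H _ h → ¬t (persistence M φ h) ; ¬t T _ → ¬t })
    (λ h → h T H≤T)
    (¬-reflects (primed-reflectsᵀ φ agreeᵀ))
  τ-reflects (φ `∧ ψ) agreeᴴ agreeᵀ =
    τ-reflects φ (agreeᴴ ∘ ∈-++⁺ˡ) (agreeᵀ ∘ ∈-++⁺ˡ)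
      ×-reflects τ-reflects ψ (agreeᴴ ∘ ∈-++⁺ʳ (var φ)) (agreeᵀ ∘ ∈-++⁺ʳ (var φ))
  τ-reflects (φ `∨ ψ) agreeᴴ agreeᵀ =
    τ-reflects φ (agreeᴴ ∘ ∈-++⁺ˡ) (agreeᵀ ∘ ∈-++⁺ˡ)
      ⊎-reflects τ-reflects ψ (agreeᴴ ∘ ∈-++⁺ʳ (var φ)) (agreeᵀ ∘ ∈-++⁺ʳ (var φ))
  τ-reflects (φ `⊃ ψ) agreeᴴ agreeᵀ = reflects-map
    (λ { (h , t) H _ → h ; (h , t) T _ → t })
    (λ f → f H refl , f T H≤T)
    ((¬-reflects (τ-reflects φ (agreeᴴ ∘ ∈-++⁺ˡ) (agreeᵀ ∘ ∈-++⁺ˡ))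
        ⊎-reflects τ-reflects ψ (agreeᴴ ∘ ∈-++⁺ʳ (var φ)) (agreeᵀ ∘ ∈-++⁺ʳ (var φ)))
      ×-reflects
     (¬-reflects (primed-reflectsᵀ φ (agreeᵀ ∘ ∈-++⁺ˡ))
        ⊎-reflects primed-reflectsᵀ ψ (agreeᵀ ∘ ∈-++⁺ʳ (var φ))))

  ≤ᶠ-reflects : ∀ {K} (f g : A → Atom⁺ A) ps →
    Reflects (All (λ p → K (f p) ≡ true → K (g p) ≡ true) ps)
             (eval K ⌜ Vec.map (atom ∘ f) (fromList ps) ≤ᶠ Vec.map (atom ∘ g) (fromList ps) ⌝)
  ≤ᶠ-reflects f g []       = of []
  ≤ᶠ-reflects f g (p ∷ ps) = reflects-map
    (λ (h , hs) → h ∷ hs) (λ { (h ∷ hs) → h , hs })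
    ((reflects-≡true refl →-reflects reflects-≡true refl) ×-reflects ≤ᶠ-reflects f g ps)

  <′-reflects : ∀ {K} ps →
    Reflects (  All (λ p → K (inj₁ p) ≡ true → K (inj₂ p) ≡ true) ps
             × ¬ All (λ p → K (inj₂ p) ≡ true → K (inj₁ p) ≡ true) ps)
             (eval K ⌜ ps <′ ⌝)
  <′-reflects ps = ≤ᶠ-reflects inj₁ inj₂ ps ×-reflects ¬-reflects (≤ᶠ-reflects inj₂ inj₁ ps)

  inj₂∉unprimed : ∀ {p} (ps : List A) → inj₂ p ∉ unprimed ps
  inj₂∉unprimed ps p∈ with () ← proj₂ (proj₂ (∈-map⁻ inj₁ p∈))

  -- An HT-interpretation and an interpretation of the doubled alphabet are
  -- compared on the variables V of a fixed theory only.
  module Correctness (Γ : Theory A) where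

    V : List A
    V = varᵀ Γ

    ⋀⇒V : ∀ {p} → p ∈ var (⋀ Γ) → p ∈ V
    ⋀⇒V = subst (_ ∈_) (var-⋀ Γ)

    HTModel⇔τ : ∀ {M K} → (K ∘ inj₁) ≐ at M H on V → (K ∘ inj₂) ≐ at M T on V →
                HTModel M Γ ⇔ (eval K ⌜ τ (⋀ Γ) ⌝ ≡ true)
    HTModel⇔τ {M} {K} agreeᴴ agreeᵀ =
      mk⇔ (from r ∘ to (HTModel⇔⋀ Γ)) (from (HTModel⇔⋀ Γ) ∘ to r)
      where r = reflects⇒⇔ (τ-reflects {M} {K} (⋀ Γ) (agreeᴴ ∘ ⋀⇒V) (agreeᵀ ∘ ⋀⇒V))

    totalModel⇔primed : ∀ {I K} → (K ∘ inj₂) ≐ I on V →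
                        HTModel (total I) Γ ⇔ (eval K ⌜ (⋀ Γ) ′ ⌝ ≡ true)
    totalModel⇔primed {I} {K} agree =
      mk⇔ (from r ∘ to (HTModel⇔⋀ Γ)) (from (HTModel⇔⋀ Γ) ∘ to r)
      where r = reflects⇒⇔ (primed-reflects-total {I} {K} (⋀ Γ) (agree ∘ ⋀⇒V))

    equilibrium-supported : ∀ {I} → EquilibriumModel Γ I → ⟦ I ⟧ Unary.⊆ (_∈ V)
    equilibrium-supported {I} (model , minimal) {p} p∈I with p ∈? V
    ... | yes p∈V = p∈V
    ... | no p∉V  = ⊥-elim (minimal J (J⊆I , p∉J ∘ λ I⊆J → I⊆J p∈I) smaller)
      where
      J = restrict V I
      J⊆I : ⟦ J ⟧ Unary.⊆ ⟦ I ⟧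
      J⊆I = proj₂ ∘ ∈-restrict V I
      p∉J : ¬ J p ≡ true
      p∉J = p∉V ∘ proj₁ ∘ ∈-restrict V I
      -- Both ⟨ I , I ⟩ and ⟨ J , I ⟩ are described on V by the pair (I , I).
      smaller : HTModel ⟨ J , I ⟩[ J⊆I ] Γ
      smaller = from (HTModel⇔τ {_} {[ I , I ]′} (sym ∘ restrict-on V I) (λ _ → refl))
                  (to (HTModel⇔τ {total I} {[ I , I ]′} (λ _ → refl) (λ _ → refl)) model)

    eval-𝒯ᴱ : ∀ K → eval K (𝒯ᴱ Γ) ≡ true ⇔
      ( eval K ⌜ (⋀ Γ) ′ ⌝ ≡ true
      × ¬ (∃[ L ] (K ≐ L off unprimed V × eval L ⌜ V <′ `∧ τ (⋀ Γ) ⌝ ≡ true)))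
    eval-𝒯ᴱ K = reflects⇒⇔ (reflects-≡true refl ×-reflects
      ¬-reflects (reflects-map (to ∃L) (from ∃L) (reflects-≡true refl)))
      where ∃L = eval-∃* (unprimed V) ⌜ V <′ `∧ τ (⋀ Γ) ⌝ K

    -- Truth of the encoding in K means that the set I of atoms of V matching the
    -- primed part of K is an equilibrium model.
    encoding : ∀ {I K} → (K ∘ inj₂) ≐ I on V → ⟦ I ⟧ Unary.⊆ (_∈ V) →
               EquilibriumModel Γ I ⇔ (eval K (𝒯ᴱ Γ) ≡ true)
    encoding {I} {K} agree supported = mk⇔ f g
      where
      f : EquilibriumModel Γ I → eval K (𝒯ᴱ Γ) ≡ true
      f (model , minimal) = from (eval-𝒯ᴱ K) (to (totalModel⇔primed {I} {K} agree) model , none)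
        where
        none : ¬ (∃[ L ] (K ≐ L off unprimed V × eval L ⌜ V <′ `∧ τ (⋀ Γ) ⌝ ≡ true))
        none (L , K≐L , eq) = minimal J (J⊆I , I⊈J)
          (from (HTModel⇔τ {_} {L} (sym ∘ restrict-on V (L ∘ inj₁)) L≐I) (∧-conicalʳ _ _ eq))
          where
          -- The formula V <′ says nothing about atoms outside V, so the unprimed
          -- part of L is below I only once it is cut down to V.
          J = restrict V (L ∘ inj₁)
          below = to (reflects⇒⇔ (<′-reflects V)) (∧-conicalˡ _ _ eq)
          L≐I : (L ∘ inj₂) ≐ I on V
          L≐I p∈V = trans (sym (K≐L (inj₂∉unprimed V))) (agree p∈V)
          J⊆I : ⟦ J ⟧ Unary.⊆ ⟦ I ⟧
          J⊆I p∈J with p∈V , p∈L ← ∈-restrict V (L ∘ inj₁) p∈J =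
            trans (sym (L≐I p∈V)) (All.lookup (proj₁ below) p∈V p∈L)
          I⊈J : ¬ ⟦ I ⟧ Unary.⊆ ⟦ J ⟧
          I⊈J I⊆J = proj₂ below (All.tabulate λ p∈V p∈L →
            proj₂ (∈-restrict V (L ∘ inj₁) (I⊆J (trans (sym (L≐I p∈V)) p∈L))))
      g : eval K (𝒯ᴱ Γ) ≡ true → EquilibriumModel Γ I
      g eq = from (totalModel⇔primed {I} {K} agree) (proj₁ parts) , minimal
        where
        parts = to (eval-𝒯ᴱ K) eq
        minimal : ∀ J → (J⊂I : ⟦ J ⟧ Unary.⊂ ⟦ I ⟧) → ¬ HTModel ⟨ J , I ⟩[ proj₁ J⊂I ] Γ
        minimal J (J⊆I , I⊈J) model = proj₂ parts (L , sym ∘ L-off , L-true)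
          where
          JK = [ J , K ∘ inj₂ ]′
          L = override (unprimed V) JK K
          L-off : L ≐ K off unprimed V
          L-off = override-off (unprimed V) JK K
          Lᴴ : (L ∘ inj₁) ≐ J on V
          Lᴴ p∈V = override-on (unprimed V) JK K (∈-map⁺ inj₁ p∈V)
          Lᵀ : (L ∘ inj₂) ≐ I on V
          Lᵀ p∈V = trans (L-off (inj₂∉unprimed V)) (agree p∈V)
          -- I has no atoms outside V, so I ⊆ J can be checked on V.
          below : eval L ⌜ V <′ ⌝ ≡ true
          below = from (reflects⇒⇔ (<′-reflects V))
            ( All.tabulate (λ p∈V p∈J → trans (Lᵀ p∈V) (J⊆I (trans (sym (Lᴴ p∈V)) p∈J)))
            , λ I≤J → I⊈J λ p∈I → let p∈V = supported p∈I in
                trans (sym (Lᴴ p∈V)) (All.lookup I≤J p∈V (trans (Lᵀ p∈V) p∈I)))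
          L-true : eval L ⌜ V <′ `∧ τ (⋀ Γ) ⌝ ≡ true
          L-true = cong₂ _∧_ below (to (HTModel⇔τ {_} {L} Lᴴ Lᵀ) model)

    -- The equilibrium model read off from an interpretation satisfying 𝒯ᴱ Γ.
    decode : Interpretation (Atom⁺ A) → Interpretation A
    decode K = restrict V (K ∘ inj₂)

    decode-agrees : ∀ K → (K ∘ inj₂) ≐ decode K on V
    decode-agrees K = sym ∘ restrict-on V (K ∘ inj₂)

    decode-equilibrium : ∀ {K} → eval K (𝒯ᴱ Γ) ≡ true → EquilibriumModel Γ (decode K)
    decode-equilibrium {K} =
      from (encoding {K = K} (decode-agrees K) (proj₁ ∘ ∈-restrict V (K ∘ inj₂)))

    -- An equilibrium model I is realised by setting the primed copy of any
    -- ps ⊇ V according to I, whatever the other atoms are.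
    realise : ∀ {I} ps → V ⊆ ps → EquilibriumModel Γ I → ∀ K →
      ∃[ L ] (K ≐ L off primed ps × (L ∘ inj₂) ≐ I on ps × eval L (𝒯ᴱ Γ) ≡ true)
    realise {I} ps V⊆ps equilibrium K =
      L , (sym ∘ override-off (primed ps) II K) , L≐I ,
      to (encoding {K = L} (L≐I ∘ V⊆ps) (equilibrium-supported equilibrium)) equilibrium
      where
      II = [ I , I ]′
      L = override (primed ps) II K
      L≐I : (L ∘ inj₂) ≐ I on ps
      L≐I p∈ps = override-on (primed ps) II K (∈-map⁺ inj₂ p∈ps)

-- Existence of equilibrium models, brave and skeptical consequence

corollary1 : {A : Set} (_≟_ : DecidableEquality A) (Γ : Theory A) (φ : Formula A) →
    let open QBFSemantics _≟_
        V = varᵀ Γ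
        W = varᵀ (φ ∷ Γ)
    in
      (HasEquilibriumModel Γ ⇔ (⊨ ∃* (primed V) (𝒯ᴱ Γ)))
    × ( (Γ ∣∼ᵇ φ → ⊨ ∃* (primed W) (𝒯ᴱ Γ `∧ ⌜ φ ′ ⌝))
      × (var φ ⊆ V → ⊨ ∃* (primed W) (𝒯ᴱ Γ `∧ ⌜ φ ′ ⌝) → Γ ∣∼ᵇ φ))
    × ( (var φ ⊆ V → Γ ∣∼ˢ φ → ⊨ ∀* (primed W) (𝒯ᴱ Γ `⊃ ⌜ φ ′ ⌝))
      × ((⊨ ∀* (primed W) (𝒯ᴱ Γ `⊃ ⌜ φ ′ ⌝)) → Γ ∣∼ˢ φ))
corollary1 {A} _≟_ Γ φ =
  mk⇔ existence existence⁻¹ , (brave , brave⁻¹) , (skeptical , skeptical⁻¹)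
  where
  open QBFSemantics _≟_ using (⊨_)
  open Evaluation (≡-dec _≟_ _≟_)
  open Encoding _≟_
  open Correctness Γ

  W : List A
  W = varᵀ (φ ∷ Γ)

  φ-holds : ∀ {I K} → (K ∘ inj₂) ≐ I on var φ → (eval K ⌜ φ ′ ⌝ ≡ true) ⇔ (total I ⊨ᴴᵀ φ)
  φ-holds {I} {K} agree = reflects⇒⇔ (primed-reflects-total {I} {K} φ agree)

  ⊃-true : ∀ {K} → eval K (𝒯ᴱ Γ `⊃ ⌜ φ ′ ⌝) ≡ true ⇔
                   (eval K (𝒯ᴱ Γ) ≡ true → eval K ⌜ φ ′ ⌝ ≡ true)
  ⊃-true = reflects⇒⇔ (reflects-≡true refl →-reflects reflects-≡true refl)

  -- Validity gives a witness at every interpretation; a fixed one is enough.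
  ∅ : Interpretation (Atom⁺ A)
  ∅ = const false

  existence : HasEquilibriumModel Γ → ⊨ ∃* (primed V) (𝒯ᴱ Γ)
  existence (I , equilibrium) = from (⊨⇔eval _) λ K →
    let L , K≐L , _ , eq = realise V id equilibrium K
    in from (eval-∃* (primed V) _ K) (L , K≐L , eq)

  existence⁻¹ : ⊨ ∃* (primed V) (𝒯ᴱ Γ) → HasEquilibriumModel Γ
  existence⁻¹ valid with L , _ , eq ← to (eval-∃* (primed V) _ ∅) (to (⊨⇔eval _) valid ∅) =
    decode L , decode-equilibrium eq

  brave : Γ ∣∼ᵇ φ → ⊨ ∃* (primed W) (𝒯ᴱ Γ `∧ ⌜ φ ′ ⌝)
  brave (I , equilibrium , I⊨φ) = from (⊨⇔eval _) λ K →
    let L , K≐L , L≐I , eq = realise W (∈-++⁺ʳ (var φ)) equilibrium K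
    in from (eval-∃* (primed W) _ K)
         (L , K≐L , cong₂ _∧_ eq (from (φ-holds {I} {L} (L≐I ∘ ∈-++⁺ˡ)) I⊨φ))

  brave⁻¹ : var φ ⊆ V → ⊨ ∃* (primed W) (𝒯ᴱ Γ `∧ ⌜ φ ′ ⌝) → Γ ∣∼ᵇ φ
  brave⁻¹ φ⊆V valid
    with L , _ , eq ← to (eval-∃* (primed W) _ ∅) (to (⊨⇔eval _) valid ∅) =
    decode L , decode-equilibrium (∧-conicalˡ _ _ eq)
             , to (φ-holds {decode L} {L} (decode-agrees L ∘ φ⊆V)) (∧-conicalʳ _ _ eq)

  skeptical : var φ ⊆ V → Γ ∣∼ˢ φ → ⊨ ∀* (primed W) (𝒯ᴱ Γ `⊃ ⌜ φ ′ ⌝)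
  skeptical φ⊆V entails = from (⊨⇔eval _) λ K → from (eval-∀* (primed W) _ K) λ L _ →
    from ⊃-true λ eq → from (φ-holds {decode L} {L} (decode-agrees L ∘ φ⊆V))
      (entails (decode L) (decode-equilibrium eq))

  -- Here the pair (I , I) is itself an instance of the universal block.
  skeptical⁻¹ : (⊨ ∀* (primed W) (𝒯ᴱ Γ `⊃ ⌜ φ ′ ⌝)) → Γ ∣∼ˢ φ
  skeptical⁻¹ valid I equilibrium = to (φ-holds {I} {K} (λ _ → refl)) (to ⊃-true
    (to (eval-∀* (primed W) _ K) (to (⊨⇔eval _) valid K) K (λ _ → refl))
    (to (encoding {I} {K} (λ _ → refl) (equilibrium-supported equilibrium)) equilibrium))
    where K = [ I , I ]′
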